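{- Let $P(x_{1},\dots,x_{n})\in\mathbb{Z}[x_{1},\dots,x_{n}]$ be a polynomial with constant term $0$ whose variables are exactly $x_{1},\dots,x_{n}$, and suppose that $P$ can be factorized as $$P(x_{1},\dots,x_{n})=\prod_{i=1}^{k}Q_{i}(x_{1},\dots,x_{n}),$$ where each $Q_{i}$ is a polynomial with integer coefficients whose set of variables is a subset of $\{x_{1},\dots,x_{n}\}$. If $P$ is partition regular on $\mathbb{N}$, then there exists an index $i\in\{1,\dots,k\}$ such that $Q_{i}$ is partition regular on $\mathbb{N}$.
   Context: Here $\mathbb{N}=\{1,2,3,\dots\}$. A polynomial $P(x_{1},\dots,x_{n})$ with integer coefficients is partition regular on $\mathbb{N}$ if, for every finite coloration $\mathbb{N}=A_{1}\cup\dots\cup A_{r}$ of $\mathbb{N}$, the equation $P(x_{1},\dots,x_{n})=0$ has a monochromatic solution, i.e. there are an index $j\leq r$ and elements $a_{1},\dots,a_{n}\in A_{j}$ (not required to be distinct) with $P(a_{1},\dots,a_{n})=0$. -}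

module Defs where

open import Data.Fin using (Fin)
open import Data.Integer as ℤ using (ℤ; 0ℤ; 1ℤ)
open import Data.List as List using (List; []; _∷_)
open import Data.Nat as ℕ using (ℕ)
open import Data.Nat.Properties using (_≟_)
open import Data.Product using (_×_; _,_; ∃-syntax; proj₁; proj₂)
open import Data.Refinement using (Refinement-syntax; value)
open import Data.Vec as Vec using (Vec)
open import Data.Vec.Functional as Vector using (Vector)
open import Data.Vec.Properties using (≡-dec)
open import Data.Vec.Relation.Unary.All using (All)
open import Relation.Binary.PropositionalEquality using (_≡_; _≢_)

-- The vector of exponents of x₁, …, xₙ.
Monomial : ℕ → Set
Monomial n = Vec ℕ n

-- A formal sum of terms c · xᵐ.  Zero coefficients and repeated monomials are
-- allowed, so equality in ℤ[x₁, …, xₙ] is _≈_ below, not _≡_.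
Polynomial : ℕ → Set
Polynomial n = List (ℤ × Monomial n)

module _ {n : ℕ} where

  unit : Monomial n
  unit = Vec.replicate n 0

  coeff : Polynomial n → Monomial n → ℤ
  coeff P m =
    List.foldr ℤ._+_ 0ℤ
      (List.map proj₁ (List.filter (λ t → ≡-dec _≟_ (proj₂ t) m) P))

  infix 4 _≈_
  _≈_ : Polynomial n → Polynomial n → Set
  P ≈ Q = ∀ m → coeff P m ≡ coeff Q m

  one : Polynomial n
  one = (1ℤ , unit) ∷ []

  infixl 7 _*_
  _*_ : Polynomial n → Polynomial n → Polynomial n
  _*_ = List.cartesianProductWith
          (λ (c , m) (d , l) → c ℤ.* d , Vec.zipWith ℕ._+_ m l)

  ∏ : ∀ {k} → Vector (Polynomial n) k → Polynomial n
  ∏ = Vector.foldr _*_ one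

  constantTerm : Polynomial n → ℤ
  constantTerm P = coeff P unit

  infix 4 _occursIn_
  _occursIn_ : Fin n → Polynomial n → Set
  i occursIn P = ∃[ m ] coeff P m ≢ 0ℤ × Vec.lookup m i ≢ 0

  evalMonomial : Monomial n → Vec ℤ n → ℤ
  evalMonomial m a = Vec.foldr′ ℤ._*_ 1ℤ (Vec.zipWith ℤ._^_ a m)

  eval : Polynomial n → Vec ℤ n → ℤ
  eval P a =
    List.foldr ℤ._+_ 0ℤ (List.map (λ (c , m) → c ℤ.* evalMonomial m a) P)

ℕ⁺ : Set
ℕ⁺ = [ m ∈ ℕ ∣ ℕ.NonZero m ]

toℤ : ℕ⁺ → ℤ
toℤ a = ℤ.+ value a

-- A coloration ℕ = A₁ ∪ … ∪ Aᵣ is given by its colouring map: Aⱼ is the fibre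
-- of c over j.  For a polynomial in which only some of x₁, …, xₙ occur, the
-- values of the others are irrelevant to the equation, so it does not matter
-- that they too are required to lie in Aⱼ.
PartitionRegular : ∀ {n} → Polynomial n → Set
PartitionRegular {n} P =
  ∀ r (c : ℕ⁺ → Fin r) →
  ∃[ j ] ∃[ a ] All (λ x → c x ≡ j) {n} a × eval P (Vec.map toℤ a) ≡ 0ℤ

{-# OPTIONS --safe #-}
module Submission where

-- If Q and R both fail to be partition regular, then so does Q · R: colour
-- every number by the pair of its colours in a bad coloration for Q and in a
-- bad coloration for R, and use that ℤ has no zero divisors.

open import Defs
open import Axiom.ExcludedMiddle using (ExcludedMiddle)
open import Data.Fin using (Fin; zero; suc; combine; remQuot)
open import Data.Fin.Properties using (remQuot-combine)
open import Data.Integer as ℤ using (ℤ; 0ℤ; 1ℤ)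
open import Data.Integer.Properties as ℤ using ()
open import Data.Integer.Tactic.RingSolver using (solve-∀)
open import Data.List using (List; []; _∷_; _++_; foldr; map)
open import Data.List.Membership.Propositional.Properties using (∈-++⁺ˡ; ∈-++⁺ʳ)
open import Data.List.Properties using (filter-reject)
open import Data.List.Relation.Binary.Subset.Propositional using (_⊆_)
open import Data.List.Relation.Unary.Any using (here; there)
open import Data.Nat as ℕ using (ℕ)
open import Data.Nat.Properties using (_≟_)
open import Data.Product using (∃-syntax; _×_; _,_; proj₁; proj₂)
open import Data.Sum using (_⊎_; inj₁; inj₂)
open import Data.Vec as Vec using (Vec; []; _∷_)
open import Data.Vec.Functional using (Vector)
open import Data.Vec.Properties using (≡-dec)
open import Data.Vec.Relation.Unary.All as All using (All)
open import Function using (_∘_)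
open import Level using (0ℓ)
open import Relation.Binary.Definitions using (DecidableEquality)
open import Relation.Binary.PropositionalEquality
  using (_≡_; _≢_; refl; sym; trans; cong; cong₂; module ≡-Reasoning)
open import Relation.Nullary using (¬_; yes; no; contradiction)

open ≡-Reasoning

module _ {n : ℕ} where

  infix 4 _≟ᵐ_
  _≟ᵐ_ : DecidableEquality (Monomial n)
  _≟ᵐ_ = ≡-dec _≟_

  monomials : Polynomial n → List (Monomial n)
  monomials = map proj₂

  coeff-∷-≢ : ∀ c {l m} (P : Polynomial n) → l ≢ m → coeff ((c , l) ∷ P) m ≡ coeff P m
  coeff-∷-≢ c {l} {m} P l≢m =
    cong (λ L → foldr ℤ._+_ 0ℤ (map proj₁ L))
         (filter-reject (λ t → proj₂ t ≟ᵐ m) {c , l} {P} l≢m)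

  coeff-∷-cong : ∀ t {P Q : Polynomial n} m →
                 coeff P m ≡ coeff Q m → coeff (t ∷ P) m ≡ coeff (t ∷ Q) m
  coeff-∷-cong (c , l) {P} {Q} m eq with l ≟ᵐ m
  ... | yes _ = cong (ℤ._+_ c) eq
  ... | no _ = eq

  -- All terms at `m` go, not only the first: repeated monomials are allowed, and only their sum is
  -- visible to `coeff`.
  without : Monomial n → Polynomial n → Polynomial n
  without m [] = []
  without m ((c , l) ∷ P) with l ≟ᵐ m
  ... | yes _ = without m P
  ... | no _ = (c , l) ∷ without m P

  coeff-without-≡ : ∀ m P → coeff (without m P) m ≡ 0ℤ
  coeff-without-≡ m [] = refl
  coeff-without-≡ m ((c , l) ∷ P) with l ≟ᵐ m
  ... | yes _ = coeff-without-≡ m P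
  ... | no l≢m = trans (coeff-∷-≢ c (without m P) l≢m) (coeff-without-≡ m P)

  coeff-without-≢ : ∀ {m l} P → m ≢ l → coeff (without m P) l ≡ coeff P l
  coeff-without-≢ [] m≢l = refl
  coeff-without-≢ {m} {l} ((c , k) ∷ P) m≢l with k ≟ᵐ m
  ... | yes refl = trans (coeff-without-≢ P m≢l) (sym (coeff-∷-≢ c P m≢l))
  ... | no _ = coeff-∷-cong (c , k) l (coeff-without-≢ P m≢l)

  -- Although `without` acts on lists of terms, its effect on coefficients is determined by `coeff`:
  -- it puts zero at `m` and changes nothing elsewhere.
  without-cong : ∀ m {P Q : Polynomial n} → P ≈ Q → without m P ≈ without m Q
  without-cong m {P} {Q} P≈Q l with m ≟ᵐ l
  ... | yes refl = trans (coeff-without-≡ m P) (sym (coeff-without-≡ m Q))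
  ... | no m≢l = trans (coeff-without-≢ P m≢l) (trans (P≈Q l) (sym (coeff-without-≢ Q m≢l)))

  -- This lets the list of monomials lose its head in the induction of `eval-cong-within`.
  monomials-without : ∀ {m S} P → monomials P ⊆ m ∷ S → monomials (without m P) ⊆ S
  monomials-without {m} ((c , l) ∷ P) P⊆S p with l ≟ᵐ m
  ... | yes _ = monomials-without P (P⊆S ∘ there) p
  monomials-without ((c , l) ∷ P) P⊆S (there p) | no _ = monomials-without P (P⊆S ∘ there) p
  monomials-without ((c , l) ∷ P) P⊆S (here refl) | no l≢m with P⊆S (here refl)
  ... | here l≡m = contradiction l≡m l≢m
  ... | there l∈S = l∈S

  -- Collecting the scattered terms at `m` makes their contribution depend on `P` only through
  -- `coeff P m`, a quantity that `≈` preserves.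
  eval-without : ∀ m P a → eval P a ≡ coeff P m ℤ.* evalMonomial m a ℤ.+ eval (without m P) a
  eval-without m [] a = refl
  eval-without m ((c , l) ∷ P) a with l ≟ᵐ m
  ... | yes refl = begin
    c ℤ.* x ℤ.+ eval P a  ≡⟨ cong (ℤ._+_ (c ℤ.* x)) (eval-without m P a) ⟩
    c ℤ.* x ℤ.+ (coeff P m ℤ.* x ℤ.+ e)  ≡⟨ regroup c (coeff P m) x e ⟩
    (c ℤ.+ coeff P m) ℤ.* x ℤ.+ e  ∎
    where
    x = evalMonomial m a
    e = eval (without m P) a
    regroup : ∀ c d x e → c ℤ.* x ℤ.+ (d ℤ.* x ℤ.+ e) ≡ (c ℤ.+ d) ℤ.* x ℤ.+ e
    regroup = solve-∀
  ... | no _ = begin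
    t ℤ.+ eval P a  ≡⟨ cong (ℤ._+_ t) (eval-without m P a) ⟩
    t ℤ.+ (coeff P m ℤ.* x ℤ.+ e)  ≡⟨ swap t (coeff P m ℤ.* x) e ⟩
    coeff P m ℤ.* x ℤ.+ (t ℤ.+ e)  ∎
    where
    t = c ℤ.* evalMonomial l a
    x = evalMonomial m a
    e = eval (without m P) a
    swap : ∀ x y z → x ℤ.+ (y ℤ.+ z) ≡ y ℤ.+ (x ℤ.+ z)
    swap = solve-∀

  -- ≈ compares coefficients, not lists of terms, so the induction is on a common
  -- list of monomials, each removed from both sides at once.
  eval-cong-within : ∀ S {P Q : Polynomial n} → monomials P ⊆ S → monomials Q ⊆ S →
                     P ≈ Q → ∀ a → eval P a ≡ eval Q a
  eval-cong-within [] {[]} {[]} _ _ _ a = refl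
  eval-cong-within [] {[]} {_ ∷ _} _ Q⊆S _ a with () ← Q⊆S (here refl)
  eval-cong-within [] {_ ∷ _} P⊆S _ _ a with () ← P⊆S (here refl)
  eval-cong-within (m ∷ S) {P} {Q} P⊆S Q⊆S P≈Q a = begin
    eval P a
      ≡⟨ eval-without m P a ⟩
    coeff P m ℤ.* evalMonomial m a ℤ.+ eval (without m P) a
      ≡⟨ cong₂ (λ c e → c ℤ.* evalMonomial m a ℤ.+ e) (P≈Q m)
           (eval-cong-within S {without m P} {without m Q} (monomials-without P P⊆S)
             (monomials-without Q Q⊆S) (without-cong m {P} {Q} P≈Q) a) ⟩
    coeff Q m ℤ.* evalMonomial m a ℤ.+ eval (without m Q) a
      ≡⟨ eval-without m Q a ⟨
    eval Q a ∎

  eval-cong : ∀ {P Q : Polynomial n} → P ≈ Q → ∀ a → eval P a ≡ eval Q a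
  eval-cong {P} {Q} =
    eval-cong-within (monomials P ++ monomials Q) {P} {Q} ∈-++⁺ˡ (∈-++⁺ʳ (monomials P))

  eval-++ : ∀ (P Q : Polynomial n) a → eval (P ++ Q) a ≡ eval P a ℤ.+ eval Q a
  eval-++ [] Q a = sym (ℤ.+-identityˡ _)
  eval-++ ((c , m) ∷ P) Q a =
    trans (cong (ℤ._+_ (c ℤ.* evalMonomial m a)) (eval-++ P Q a))
      (sym (ℤ.+-assoc (c ℤ.* evalMonomial m a) (eval P a) (eval Q a)))

evalMonomial-unit : ∀ {n} (a : Vec ℤ n) → evalMonomial unit a ≡ 1ℤ
evalMonomial-unit [] = refl
evalMonomial-unit (x ∷ a) = trans (ℤ.*-identityˡ _) (evalMonomial-unit a)

evalMonomial-+ : ∀ {n} (m l : Monomial n) a →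
  evalMonomial (Vec.zipWith ℕ._+_ m l) a ≡ evalMonomial m a ℤ.* evalMonomial l a
evalMonomial-+ [] [] [] = refl
evalMonomial-+ (i ∷ m) (j ∷ l) (x ∷ a) = trans
  (cong₂ ℤ._*_ (ℤ.^-distribˡ-+-* x i j) (evalMonomial-+ m l a))
  (interchange (x ℤ.^ i) (x ℤ.^ j) (evalMonomial m a) (evalMonomial l a))
  where
  interchange : ∀ x y z w → (x ℤ.* y) ℤ.* (z ℤ.* w) ≡ (x ℤ.* z) ℤ.* (y ℤ.* w)
  interchange = solve-∀

module _ {n : ℕ} where

  eval-one : ∀ a → eval (one {n}) a ≡ 1ℤ
  eval-one a = trans (ℤ.+-identityʳ _) (trans (ℤ.*-identityˡ _) (evalMonomial-unit a))

  -- The mapped list is the block of `P * Q` that a single term of `P` contributes.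
  eval-term-* : ∀ c m (Q : Polynomial n) a →
    eval (map (λ (d , l) → c ℤ.* d , Vec.zipWith ℕ._+_ m l) Q) a ≡
    (c ℤ.* evalMonomial m a) ℤ.* eval Q a
  eval-term-* c m [] a = sym (ℤ.*-zeroʳ (c ℤ.* evalMonomial m a))
  eval-term-* c m ((d , l) ∷ Q) a = trans
    (cong₂ (λ x y → (c ℤ.* d) ℤ.* x ℤ.+ y) (evalMonomial-+ m l a) (eval-term-* c m Q a))
    (regroup c d (evalMonomial m a) (evalMonomial l a) (eval Q a))
    where
    regroup : ∀ c d x y e →
      (c ℤ.* d) ℤ.* (x ℤ.* y) ℤ.+ (c ℤ.* x) ℤ.* e ≡ (c ℤ.* x) ℤ.* (d ℤ.* y ℤ.+ e)
    regroup = solve-∀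

  eval-* : ∀ (P Q : Polynomial n) a → eval (P * Q) a ≡ eval P a ℤ.* eval Q a
  eval-* [] Q a = refl
  eval-* ((c , m) ∷ P) Q a = begin
    eval (map _ Q ++ P * Q) a  ≡⟨ eval-++ (map _ Q) (P * Q) a ⟩
    eval (map _ Q) a ℤ.+ eval (P * Q) a  ≡⟨ cong₂ ℤ._+_ (eval-term-* c m Q a) (eval-* P Q a) ⟩
    t ℤ.* eval Q a ℤ.+ eval P a ℤ.* eval Q a  ≡⟨ ℤ.*-distribʳ-+ (eval Q a) t (eval P a) ⟨
    (t ℤ.+ eval P a) ℤ.* eval Q a  ∎
    where t = c ℤ.* evalMonomial m a

  -- The factorization is given only up to `≈`; since evaluations agree, the same monochromatic
  -- solution serves both sides.
  PartitionRegular-resp-≈ : ∀ {P Q : Polynomial n} → P ≈ Q → PartitionRegular P → PartitionRegular Q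
  PartitionRegular-resp-≈ {P} {Q} P≈Q regular r c with regular r c
  ... | j , a , mono , P[a]≡0 =
    j , a , mono , trans (sym (eval-cong {P = P} {Q} P≈Q (Vec.map toℤ a))) P[a]≡0

  -- This excludes the empty product. One colour is enough, because `one` has the value 1 everywhere
  -- and hence no zeros.
  ¬PartitionRegular-one : ¬ PartitionRegular (one {n})
  ¬PartitionRegular-one regular with regular 1 (λ _ → zero)
  ... | _ , a , _ , one[a]≡0 with () ← trans (sym (eval-one (Vec.map toℤ a))) one[a]≡0

  PartitionRegular-* : ExcludedMiddle 0ℓ → ∀ (Q R : Polynomial n) →
    PartitionRegular (Q * R) → PartitionRegular Q ⊎ PartitionRegular R
  PartitionRegular-* em Q R regular with em {PartitionRegular Q}
  ... | yes Q-regular = inj₁ Q-regular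
  ... | no ¬Q-regular = inj₂ R-regular
    where
    R-regular : PartitionRegular R
    -- No bad coloration for `Q` has to be extracted: a single `c` that is bad for `R` already
    -- forces `Q` to be partition regular, by pairing `c` with an arbitrary `d`.
    R-regular r c with em {∃[ j ] ∃[ a ] All (λ x → c x ≡ j) {n} a × eval R (Vec.map toℤ a) ≡ 0ℤ}
    ... | yes solution = solution
    ... | no ¬solution = contradiction Q-regular ¬Q-regular
      where
      -- Decoding the paired colour shows that a tuple monochromatic for the pairing is
      -- monochromatic for each of the two colorations.
      colours : ∀ {s j} (i : Fin s) (k : Fin r) → combine i k ≡ j → (i , k) ≡ remQuot r j
      colours i k eq = trans (sym (remQuot-combine i k)) (cong (remQuot r) eq)

      Q-regular : PartitionRegular Q
      Q-regular s d with regular (s ℕ.* r) (λ x → combine (d x) (c x))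
      ... | j , a , mono , QR[a]≡0
          with ℤ.i*j≡0⇒i≡0∨j≡0 (eval Q (Vec.map toℤ a))
                 (trans (sym (eval-* Q R (Vec.map toℤ a))) QR[a]≡0)
      ... | inj₁ Q[a]≡0 =
        -- The colour left to inference is `proj₁ (remQuot r j)`.
        _ , a , All.map (λ {x} → cong proj₁ ∘ colours (d x) (c x)) mono , Q[a]≡0
      ... | inj₂ R[a]≡0 =
        contradiction (_ , a , All.map (λ {x} → cong proj₂ ∘ colours (d x) (c x)) mono , R[a]≡0) ¬solution

  PartitionRegular-∏ : ExcludedMiddle 0ℓ → ∀ {k} (Q : Vector (Polynomial n) k) →
    PartitionRegular (∏ Q) → ∃[ i ] PartitionRegular (Q i)
  PartitionRegular-∏ em {ℕ.zero} Q regular = contradiction regular ¬PartitionRegular-one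
  PartitionRegular-∏ em {ℕ.suc k} Q regular
    -- As a right fold, `∏ Q` unfolds by definition to `Q zero * ∏ (Q ∘ suc)`, so `regular` applies
    -- unchanged.
    with PartitionRegular-* em (Q zero) (∏ (Q ∘ suc)) regular
  ... | inj₁ head-regular = zero , head-regular
  ... | inj₂ tail-regular with PartitionRegular-∏ em (Q ∘ suc) tail-regular
  ... | i , Qᵢ-regular = suc i , Qᵢ-regular

theorem3p8 : ExcludedMiddle 0ℓ →
    ∀ {n k : ℕ} (P : Polynomial n) (Q : Vector (Polynomial n) k) →
    constantTerm P ≡ 0ℤ →
    (∀ (i : Fin n) → i occursIn P) →
    P ≈ ∏ Q →
    PartitionRegular P →
    ∃[ i ] PartitionRegular (Q i)
theorem3p8 em P Q _ _ P≈∏Q regular =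
  PartitionRegular-∏ em Q (PartitionRegular-resp-≈ {P = P} {∏ Q} P≈∏Q regular)
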